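{- Let $k\ge 1$ and let $H_1,\ldots,H_k$ be non-bipartite graphs, and let $r^*:=r^*(H_1,\ldots,H_k)$. For every $\varepsilon>0$ there is $n_0$ such that for all $n\ge n_0$, $$\mathrm{nim}(n;H_1,\ldots,H_k)\le \left(1-\frac{1}{r^*}\right)\frac{n^2}{2}+\varepsilon n^2.$$ Furthermore, if each $H_i$ is connected, or if there exists a feasible colouring $\xi:\binom{[r^*]}{\le 2}\to[k]$ (with respect to $(H_1,\ldots,H_k)$) that assigns the same colour to all singletons, then $\mathrm{nim}(n;H_1,\ldots,H_k)\ge t(n,r^*)$.
   Context: For a $k$-edge-colouring $\phi$ of $K_n$, an edge is a NIM-edge if for no $i\in[k]$ it is contained in a copy of $H_i$ all of whose edges have colour $i$; $\mathrm{nim}(\phi;H_1,\ldots,H_k)$ is the number of NIM-edges, and $\mathrm{nim}(n;H_1,\ldots,H_k)$ is the maximum of this over all $k$-edge-colourings of $K_n$. A homomorphism $H\to G$ is a (not necessarily injective) map $V(H)\to V(G)$ sending edges to edges. For a set $X$, $\binom{X}{\le 2}$ is the set of subsets of $X$ of size at most 2. A colouring $\xi:\binom{[r]}{\le 2}\to[k]$ is feasible (with respect to $(H_1,\ldots,H_k)$) if (P1) for each $i\in[k]$ there is no homomorphism from $H_i$ to the graph on $[r]$ whose edges are the pairs $\{a,b\}$ with $\xi(\{a,b\})=i$, and (P2) for all distinct $a,b\in[r]$, $\xi(\{a,b\})\ne\xi(\{a\})$. Then $r^*(H_1,\ldots,H_k)$ is the maximum $r$ for which a feasible colouring of $\binom{[r]}{\le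 2}$ exists. $T(n,r)$ is the Turán graph (complete balanced $r$-partite graph on $n$ vertices) and $t(n,r)=e(T(n,r))$. -}

module Defs where

open import Data.Nat using (ℕ; zero; suc; _+_; _*_; _∸_; _≤_; _<ᵇ_; _%_)
open import Data.Nat as ℕ using ()
open import Data.Bool using (Bool; true; false; _∧_; _∨_; not; if_then_else_)
open import Data.Fin using (Fin; toℕ; _≟_)
open import Data.List using (List; []; _∷_; map; concatMap; allFin; length; filterᵇ)
open import Data.Bool.ListAction using (all; any)
open import Data.Product using (Σ; _×_; _,_; ∃)
open import Relation.Binary.PropositionalEquality using (_≡_; _≢_)
open import Relation.Nullary using (¬_)
open import Relation.Nullary.Decidable using (⌊_⌋)

record Graph : Set where
  field
    size   : ℕ
    adj    : Fin size → Fin size → Bool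
    sym    : ∀ u v → adj u v ≡ adj v u
    irrefl : ∀ u → adj u u ≡ false
open Graph public

Bipartite : Graph → Set
Bipartite G = Σ (Fin (size G) → Bool) λ c →
  ∀ u v → adj G u v ≡ true → c u ≢ c v

data Reach (G : Graph) : Fin (size G) → Fin (size G) → Set where
  here : ∀ {u} → Reach G u u
  step : ∀ {u v w} → adj G u v ≡ true → Reach G v w → Reach G u w

Connected : Graph → Set
Connected G = ∀ u v → Reach G u v

-- k-edge-colourings of K_n (values on the diagonal are irrelevant).

record Colouring (n k : ℕ) : Set where
  field
    col : Fin n → Fin n → Fin k
    col-sym : ∀ u v → col u v ≡ col v u
open Colouring public

allFuns : (m n : ℕ) → List (Fin m → Fin n)
allFuns zero    n = (λ ()) ∷ []
allFuns (suc m) n =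
  concatMap (λ x → map (λ g → λ { Fin.zero → x ; (Fin.suc a) → g a }) (allFuns m n))
            (allFin n)

eqᵇ : ∀ {n} → Fin n → Fin n → Bool
eqᵇ a b = ⌊ a ≟ b ⌋

pairs : (m : ℕ) → List (Fin m × Fin m)
pairs m = concatMap (λ a → map (λ b → (a , b)) (allFin m)) (allFin m)

isMonoCopy : ∀ {n k} → Colouring n k → (H : Graph) → Fin k → (Fin (size H) → Fin n) → Bool
isMonoCopy φ H i g =
  all (λ { (a , b) → eqᵇ a b ∨ not (eqᵇ (g a) (g b)) }) (pairs (size H)) ∧
  all (λ { (a , b) → not (adj H a b) ∨ eqᵇ (col φ (g a) (g b)) i }) (pairs (size H))

hitsEdge : ∀ {n} → (H : Graph) → (Fin (size H) → Fin n) → Fin n → Fin n → Bool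
hitsEdge H g u v =
  any (λ { (a , b) → adj H a b ∧ eqᵇ (g a) u ∧ eqᵇ (g b) v }) (pairs (size H))

inMonoCopy : ∀ {n k} → Colouring n k → Graph → Fin k → Fin n → Fin n → Bool
inMonoCopy {n} φ H i u v =
  any (λ g → isMonoCopy φ H i g ∧ hitsEdge H g u v) (allFuns (size H) n)

isNIM : ∀ {n k} → Colouring n k → (Fin k → Graph) → Fin n → Fin n → Bool
isNIM {k = k} φ H u v = not (any (λ i → inMonoCopy φ (H i) i u v) (allFin k))

edgesK : (n : ℕ) → List (Fin n × Fin n)
edgesK n = filterᵇ (λ { (u , v) → toℕ u <ᵇ toℕ v }) (pairs n)

nimφ : ∀ {n k} → Colouring n k → (Fin k → Graph) → ℕ
nimφ {n} φ H = length (filterᵇ (λ { (u , v) → isNIM φ H u v }) (edgesK n))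

-- Feasible colourings ξ : binom([r], ≤2) → [k].
-- ξ₁ = colours of singletons, ξ₂ = colours of pairs (symmetric; diagonal irrelevant).

Hom : (H : Graph) → (r : ℕ) → (Fin r → Fin r → Set) → Set
Hom H r E = Σ (Fin (size H) → Fin r) λ f → ∀ a b → adj H a b ≡ true → E (f a) (f b)

record Feasible {k : ℕ} (H : Fin k → Graph) (r : ℕ) : Set where
  field
    ξ₁ : Fin r → Fin k
    ξ₂ : Fin r → Fin r → Fin k
    ξ₂-sym : ∀ a b → ξ₂ a b ≡ ξ₂ b a
    P1 : ∀ i → ¬ Hom (H i) r (λ a b → a ≢ b × ξ₂ a b ≡ i)
    P2 : ∀ a b → a ≢ b → ξ₂ a b ≢ ξ₁ a
open Feasible public

IsRStar : ∀ {k} → (Fin k → Graph) → ℕ → Set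
IsRStar H r = Feasible H r × (∀ r' → Feasible H r' → r' ≤ r)

-- Turán number t(n,r): T(n,r) has parts {i < n : i mod r = j}, which are balanced.
turán : ℕ → ℕ → ℕ
turán n zero    = 0
turán n (suc s) =
  length (filterᵇ (λ { (u , v) → not (toℕ u % suc s ℕ.≡ᵇ toℕ v % suc s) }) (edgesK n))

{-# OPTIONS --safe #-}

-- Upper bound.  If for r = r* the NIM-graph has more than (1 - 1/r + 2ε) n²/2 edges, it has a large
-- induced subgraph, on m vertices, of minimum degree at least (1 - 1/r + ε) m.  The proof of the Erdős–Stone
-- theorem, with colours recorded in the pigeonhole step and Ramsey's theorem applied inside every new part,
-- then yields r + 1 large monochromatic parts, each two of which are joined completely by NIM-edges of one
-- colour.  These colours form a feasible colouring on r + 1 points, contradicting the maximality of r*: a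
-- homomorphism violating (P1) lifts to a copy of H_i through NIM-edges, and if parts a, b violate (P2), then
-- a copy of H_i with one vertex in b and all others in a uses NIM-edges.
--
-- Lower bound.  Blow up a feasible ξ on the residue classes modulo r*.  By (P2), in a monochromatic copy of
-- H_i no vertex lies both on an edge inside a class and on an edge between classes, so a connected copy using
-- an edge between classes projects to a homomorphism forbidden by (P1).  If the singletons share one colour,
-- then no edge between classes has it, so again a copy using such an edge has no edge inside a class.

module Submission where

open import Defs renaming (sym to adj-sym; irrefl to adj-irrefl)
open import Data.Bool as Bool using (Bool; true; false; _∧_; _∨_; not)
open import Data.Bool.ListAction using (any; all)
open import Data.Bool.Properties using (T-≡; ∨-comm)
open import Data.Empty using (⊥; ⊥-elim)
open import Data.Fin as Fin using (Fin; zero; suc; toℕ; punchIn; inject≤; combine; remQuot; finToFun; funToFin)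
import Data.Fin.Properties as Finₚ
open import Data.List using (List; []; _∷_; map; concatMap; allFin; length; filterᵇ; tabulate)
open import Data.List.Membership.Propositional using (_∈_)
open import Data.List.Properties using (length-++; filter-++)
import Data.List.Relation.Unary.All as All
import Data.List.Relation.Unary.All.Properties as Allₚ
open import Data.List.Relation.Unary.Any as Any using (Any; here)
import Data.List.Relation.Unary.Any.Properties as Anyₚ
open import Data.Nat as ℕ using (ℕ; zero; suc; _+_; _*_; _∸_; _^_; _≤_; _<_; z≤n; s≤s; _<ᵇ_; _<?_; _≤?_; _%_)
open import Data.Nat.DivMod using (_mod_; m%n<n)
open import Data.Nat.Properties
open import Data.Nat.Tactic.RingSolver using (solve-∀)
open import Data.Product using (Σ; _×_; _,_; ∃; proj₁; proj₂)
open import Data.Sum using (_⊎_; inj₁; inj₂)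
open import Function using (_∘_; id; const; _on_)
open import Function.Bundles using (Equivalence)
open import Function.Definitions using (Injective)
open import Relation.Binary.Definitions using (tri<; tri≈; tri>)
open import Relation.Binary.PropositionalEquality using (_≡_; _≢_; refl; sym; trans; cong; cong₂; subst)
open import Relation.Nullary using (¬_; Dec; yes; no; contradiction)
open import Relation.Nullary.Decidable using (⌊_⌋; _×-dec_; _→-dec_; T?; map′; decidable-stable)
open import Algebra.Properties.Semiring.Sum +-*-semiring
  using (sum; sum-cong-≗; sum-remove; ∑-comm; ∑-distrib-+; *-distribˡ-sum)

-- Finite sums and counting

𝟙 : Bool → ℕ
𝟙 true  = 1
𝟙 false = 0

count : ∀ {n} → (Fin n → Bool) → ℕ
count p = sum (𝟙 ∘ p)

Inj : ∀ {m n} → (Fin m → Fin n) → Set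
Inj = Injective _≡_ _≡_

⌊⌋-true : ∀ {A : Set} (d : Dec A) → A → ⌊ d ⌋ ≡ true
⌊⌋-true (yes _) _ = refl
⌊⌋-true (no ¬a) a = contradiction a ¬a

⌊⌋-sound : ∀ {A : Set} (d : Dec A) → ⌊ d ⌋ ≡ true → A
⌊⌋-sound (yes a) _ = a

∧-true : ∀ {a b} → a ∧ b ≡ true → a ≡ true × b ≡ true
∧-true {true} {true} refl = refl , refl

𝟙≤1 : ∀ b → 𝟙 b ≤ 1
𝟙≤1 true  = ≤-refl
𝟙≤1 false = z≤n

sum-mono : ∀ {n} {f g : Fin n → ℕ} → (∀ i → f i ≤ g i) → sum f ≤ sum g
sum-mono {zero}  f≤g = z≤n
sum-mono {suc n} f≤g = +-mono-≤ (f≤g zero) (sum-mono (f≤g ∘ suc))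

sum-const : ∀ n m → sum {n} (const m) ≡ n * m
sum-const zero    m = refl
sum-const (suc n) m = cong (m +_) (sum-const n m)

sum≤ : ∀ {n} (f : Fin n → ℕ) m → (∀ i → f i ≤ m) → sum f ≤ n * m
sum≤ {n} f m f≤m = ≤-trans (sum-mono f≤m) (≤-reflexive (sum-const n m))

≤sum : ∀ {n} (f : Fin n → ℕ) m → (∀ i → m ≤ f i) → n * m ≤ sum f
≤sum {n} f m m≤f = ≤-trans (≤-reflexive (sym (sum-const n m))) (sum-mono m≤f)

term≤sum : ∀ {n} (f : Fin n → ℕ) i → f i ≤ sum f
term≤sum f zero    = m≤m+n _ _
term≤sum f (suc i) = ≤-trans (term≤sum (f ∘ suc) i) (m≤n+m _ _)

-- One term is at most x and the other n - 1 are at most m; the summand m on the left avoids writing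
-- n - 1.
sum+bound≤ : ∀ {n} (f : Fin n → ℕ) {m x} → (∀ i → f i ≤ m) → ∀ i → f i ≤ x → sum f + m ≤ n * m + x
sum+bound≤ {suc n} f {m} {x} f≤m zero fi≤x = begin
  f zero + sum (f ∘ suc) + m  ≤⟨ +-monoˡ-≤ m (+-mono-≤ fi≤x (sum≤ (f ∘ suc) m (f≤m ∘ suc))) ⟩
  x + n * m + m               ≡⟨ arith x (n * m) m ⟩
  m + n * m + x               ∎
  where
  open ≤-Reasoning
  arith : ∀ x y m → x + y + m ≡ m + y + x
  arith = solve-∀
sum+bound≤ {suc n} f {m} {x} f≤m (suc i) fi≤x = begin
  f zero + sum (f ∘ suc) + m    ≡⟨ +-assoc (f zero) _ m ⟩
  f zero + (sum (f ∘ suc) + m)  ≤⟨ +-mono-≤ (f≤m zero) (sum+bound≤ (f ∘ suc) (f≤m ∘ suc) i fi≤x) ⟩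
  m + (n * m + x)               ≡⟨ sym (+-assoc m _ x) ⟩
  m + n * m + x                 ∎
  where open ≤-Reasoning

count≤ : ∀ {n} (p : Fin n → Bool) → count p ≤ n
count≤ {n} p = ≤-trans (sum≤ (𝟙 ∘ p) 1 (𝟙≤1 ∘ p)) (≤-reflexive (*-identityʳ n))

average : ∀ {n} (f : Fin n → ℕ) m → n * m < sum f → ∃ λ i → m < f i
average {suc n} f m lt with m <? f zero
... | yes m<f₀ = zero , m<f₀
... | no  m≮f₀ with average (f ∘ suc) m
                     (+-cancelˡ-< m _ _ (<-≤-trans lt (+-monoˡ-≤ _ (≮⇒≥ m≮f₀))))
...   | i , m<fi = suc i , m<fi

select : ∀ {n} (p : Fin n → Bool) t → t ≤ count p →
         Σ (Fin t → Fin n) λ f → Inj f × (∀ j → p (f j) ≡ true)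
select p zero _ = (λ ()) , (λ {i} → ⊥-elim (Finₚ.¬Fin0 i)) , λ ()
select {suc n} p (suc t) lt with p zero in eq
... | false with select (p ∘ suc) (suc t) lt
...   | f , f-inj , pf = suc ∘ f , f-inj ∘ Finₚ.suc-injective , pf
select {suc n} p (suc t) (s≤s lt) | true with select (p ∘ suc) t lt
...   | f , f-inj , pf = g , g-inj , pg
  where
  g : Fin (suc t) → Fin (suc n)
  g zero    = zero
  g (suc j) = suc (f j)
  g-inj : Inj g
  g-inj {zero}  {zero}  _  = refl
  g-inj {suc i} {suc j} gi≡gj = cong suc (f-inj (Finₚ.suc-injective gi≡gj))
  pg : ∀ j → p (g j) ≡ true
  pg zero    = eq
  pg (suc j) = pf j

-- Pigeonhole within the set `p`: each of its points lies in the fibre of its own colour, so after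
-- exchanging sums the k fibres have total size at least `count p`, and one of them has more than t
-- points.
select-fibre : ∀ {n k} (p : Fin n → Bool) (f : Fin n → Fin k) t → k * t < count p →
               ∃ λ x → Σ (Fin t → Fin n) λ g → Inj g × (∀ j → p (g j) ≡ true × f (g j) ≡ x)
select-fibre {n} {k} p f t lt = x , g , g-inj , λ j →
    proj₁ (∧-true (pg j)) , ⌊⌋-sound (f (g j) Fin.≟ x) (proj₂ (∧-true (pg j)))
  where
  fibre : Fin k → Fin n → Bool
  fibre x i = p i ∧ eqᵇ (f i) x
  covered : ∀ i → 𝟙 (p i) ≤ sum (λ x → 𝟙 (fibre x i))
  covered i = ≤-trans (≤-reflexive (cong 𝟙 (sym own))) (term≤sum (λ x → 𝟙 (fibre x i)) (f i))
    where
    own : fibre (f i) i ≡ p i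
    own with p i
    ... | false = refl
    ... | true  = ⌊⌋-true (f i Fin.≟ f i) refl
  large : ∃ λ x → t < count (fibre x)
  large = average (count ∘ fibre) t
    (<-≤-trans lt (≤-trans (sum-mono covered) (≤-reflexive (∑-comm (λ i x → 𝟙 (fibre x i))))))
  x = proj₁ large
  selection = select (fibre x) t (<⇒≤ (proj₂ large))
  g = proj₁ selection
  g-inj = proj₁ (proj₂ selection)
  pg = proj₂ (proj₂ selection)

-- Ramsey's theorem

pigeonhole : ∀ {n k} (f : Fin n → Fin k) t → k * t < n →
             ∃ λ x → Σ (Fin t → Fin n) λ g → Inj g × (∀ j → f (g j) ≡ x)
pigeonhole {n} f t lt with select-fibre (const true) f t (<-≤-trans lt (≤-reflexive (sym total)))
  where
  total : count {n} (const true) ≡ n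
  total = trans (sum-const n 1) (*-identityʳ n)
... | x , g , g-inj , fg = x , g , g-inj , proj₂ ∘ fg

-- First half of the classical proof of Ramsey's theorem: the point `zero` sends one colour to R of
-- the other k * R + 1 points, and the recursion continues among these R.
endHomogeneous : ∀ k m → ∃ λ R → (c : Fin R → Fin R → Fin k) →
  Σ (Fin m → Fin R) λ f → Inj f × Σ (Fin m → Fin k) λ d → ∀ i j → i Fin.< j → c (f i) (f j) ≡ d i
endHomogeneous k zero    = 0 , λ c → (λ ()) , (λ {i} → ⊥-elim (Finₚ.¬Fin0 i)) , (λ ()) , λ ()
endHomogeneous k (suc m) with endHomogeneous k m
... | R , hom = suc (suc (k * R)) , build
  where
  build : (c : Fin (suc (suc (k * R))) → Fin (suc (suc (k * R))) → Fin k) →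
    Σ (Fin (suc m) → _) λ f → Inj f × Σ (Fin (suc m) → Fin k) λ d →
      ∀ i j → i Fin.< j → c (f i) (f j) ≡ d i
  build c with pigeonhole (c zero ∘ suc) R ≤-refl
  ... | x , g , g-inj , cg with hom (λ i j → c (suc (g i)) (suc (g j)))
  ...   | f , f-inj , d , cf = f′ , f′-inj , d′ , cf′
    where
    f′ : Fin (suc m) → Fin (suc (suc (k * R)))
    f′ zero    = zero
    f′ (suc i) = suc (g (f i))
    f′-inj : Inj f′
    f′-inj {zero}  {zero}  _  = refl
    f′-inj {suc i} {suc j} eq = cong suc (f-inj (g-inj (Finₚ.suc-injective eq)))
    d′ : Fin (suc m) → Fin k
    d′ zero    = x
    d′ (suc i) = d i
    cf′ : ∀ i j → i Fin.< j → c (f′ i) (f′ j) ≡ d′ i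
    cf′ zero    (suc j) _         = cg (f j)
    cf′ (suc i) (suc j) (s≤s i<j) = cf i j i<j

-- Among k * t + 1 end-homogeneous points, t send the same colour forwards; symmetry of `c` settles
-- the pairs taken backwards.
ramsey : ∀ k t → ∃ λ R → (c : Fin R → Fin R → Fin k) → (∀ u v → c u v ≡ c v u) →
  ∃ λ x → Σ (Fin t → Fin R) λ f → Inj f × (∀ i j → i ≢ j → c (f i) (f j) ≡ x)
ramsey k t with endHomogeneous k (suc (k * t))
... | R , hom = R , build
  where
  build : (c : Fin R → Fin R → Fin k) → (∀ u v → c u v ≡ c v u) →
    ∃ λ x → Σ (Fin t → Fin R) λ f → Inj f × (∀ i j → i ≢ j → c (f i) (f j) ≡ x)
  build c c-sym with hom c
  ... | f , f-inj , d , cf with pigeonhole d t ≤-refl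
  ...   | x , g , g-inj , dg = x , f ∘ g , g-inj ∘ f-inj , mono
    where
    mono : ∀ i j → i ≢ j → c (f (g i)) (f (g j)) ≡ x
    mono i j i≢j with Finₚ.<-cmp (g i) (g j)
    ... | tri< lt _ _ = trans (cf _ _ lt) (dg i)
    ... | tri≈ _ eq _ = contradiction (g-inj eq) i≢j
    ... | tri> _ _ gt = trans (c-sym _ _) (trans (cf _ _ gt) (dg j))

-- Passing to a subgraph of large minimum degree

Symmetric : ∀ {n} {A : Set} → (Fin n → Fin n → A) → Set
Symmetric c = ∀ u v → c u v ≡ c v u

Irreflexive : ∀ {n} → (Fin n → Fin n → Bool) → Set
Irreflexive G = ∀ u → G u u ≡ false

deg : ∀ {n} → (Fin n → Fin n → Bool) → Fin n → ℕ
deg G v = count (G v)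

degreeSum : ∀ {n} → (Fin n → Fin n → Bool) → ℕ
degreeSum G = sum (deg G)

degreeSum≤ : ∀ {n} (G : Fin n → Fin n → Bool) → degreeSum G ≤ n * n
degreeSum≤ {n} G = sum≤ (deg G) n (count≤ ∘ G)

-- The row and the column of v each contribute `deg G v`, and irreflexivity makes their common entry
-- zero.
degreeSum-remove : ∀ {n} (G : Fin (suc n) → Fin (suc n) → Bool) → Symmetric G → Irreflexive G →
                   ∀ v → degreeSum G ≡ degreeSum (G on punchIn v) + 2 * deg G v
degreeSum-remove {n} G G-sym G-irr v = begin-equality
  sum (deg G)
    ≡⟨ sum-remove (deg G) ⟩
  deg G v + sum (λ u → deg G (punchIn v u))
    ≡⟨ cong (deg G v +_) (sum-cong-≗ (λ u → sum-remove {i = v} (𝟙 ∘ G (punchIn v u)))) ⟩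
  deg G v + sum (λ u → 𝟙 (G (punchIn v u) v) + deg (G on punchIn v) u)
    ≡⟨ cong (deg G v +_) (∑-distrib-+ (λ u → 𝟙 (G (punchIn v u) v)) (deg (G on punchIn v))) ⟩
  deg G v + (sum (λ u → 𝟙 (G (punchIn v u) v)) + degreeSum (G on punchIn v))
    ≡⟨ cong (λ x → deg G v + (x + degreeSum (G on punchIn v))) column ⟩
  deg G v + (deg G v + degreeSum (G on punchIn v))
    ≡⟨ arith (deg G v) (degreeSum (G on punchIn v)) ⟩
  degreeSum (G on punchIn v) + 2 * deg G v
    ∎
  where
  open ≤-Reasoning
  arith : ∀ x y → x + (x + y) ≡ y + 2 * x
  arith = solve-∀
  column : sum (λ u → 𝟙 (G (punchIn v u) v)) ≡ deg G v
  column = sym (trans (sum-remove {i = v} (𝟙 ∘ G v))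
    (cong₂ _+_ (cong 𝟙 (G-irr v)) (sum-cong-≗ (λ u → cong 𝟙 (G-sym v (punchIn v u))))))

-- Deleting a vertex of degree less than (C / D) n lowers D · degreeSum by less than 2 C n,
-- which is the decrement of C (n² + n).
minDegree : ∀ C D n (G : Fin n → Fin n → Bool) → Symmetric G → Irreflexive G →
  ∃ λ m → Σ (Fin m → Fin n) λ ι → Inj ι ×
    (∀ v → C * m ≤ D * deg (G on ι) v) ×
    D * degreeSum G + C * (m * m + m) ≤ D * degreeSum (G on ι) + C * (n * n + n)
minDegree C D n G G-sym G-irr with Finₚ.any? (λ v → D * deg G v <? C * n)
... | no  ¬low = n , id , id , (λ v → ≮⇒≥ (λ lt → ¬low (v , lt))) , ≤-refl
minDegree C D (suc n) G G-sym G-irr | yes (v , low)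
  with minDegree C D n (G on punchIn v) (λ _ _ → G-sym _ _) (λ _ → G-irr _)
...   | m , ι , ι-inj , high , bound =
  m , punchIn v ∘ ι , ι-inj ∘ Finₚ.punchIn-injective v _ _ , high , bound′
  where
  open ≤-Reasoning
  E E₁ E′ : ℕ
  E  = degreeSum G
  E₁ = degreeSum (G on punchIn v)
  E′ = degreeSum (G on (punchIn v ∘ ι))
  arith₁ : ∀ D E d x → D * (E + 2 * d) + x ≡ (D * E + x) + 2 * (D * d)
  arith₁ = solve-∀
  arith₂ : ∀ C n x → (x + C * (n * n + n)) + 2 * (C * suc n) ≡ x + C * (suc n * suc n + suc n)
  arith₂ = solve-∀
  bound′ : D * E + C * (m * m + m) ≤ D * E′ + C * (suc n * suc n + suc n)
  bound′ = begin
    D * E + C * (m * m + m)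
      ≡⟨ cong (λ e → D * e + C * (m * m + m)) (degreeSum-remove G G-sym G-irr v) ⟩
    D * (E₁ + 2 * deg G v) + C * (m * m + m)
      ≡⟨ arith₁ D E₁ (deg G v) (C * (m * m + m)) ⟩
    (D * E₁ + C * (m * m + m)) + 2 * (D * deg G v)
      ≤⟨ +-mono-≤ bound (*-monoʳ-≤ 2 (<⇒≤ low)) ⟩
    (D * E′ + C * (n * n + n)) + 2 * (C * suc n)
      ≡⟨ arith₂ C n (D * E′) ⟩
    D * E′ + C * (suc n * suc n + suc n)
      ∎

-- Homogeneous blow-ups of complete graphs

-- Inside a part only the colour is controlled, not `G`. Disjointness of the parts follows from
-- `cross-adj` when `G` is irreflexive. The value `cross a a` carries no meaning.
record Blowup {n k} (G : Fin n → Fin n → Bool) (c : Fin n → Fin n → Fin k) (s t : ℕ) : Set where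
  field
    part      : Fin s → Fin t → Fin n
    part-inj  : ∀ a → Inj (part a)
    inner     : Fin s → Fin k
    cross     : Fin s → Fin s → Fin k
    cross-sym : Symmetric cross
    inner-col : ∀ a i j → i ≢ j → c (part a i) (part a j) ≡ inner a
    cross-col : ∀ a b i j → a ≢ b → c (part a i) (part b j) ≡ cross a b
    cross-adj : ∀ a b i j → a ≢ b → G (part a i) (part b j) ≡ true

-- Fin (k * T ^ t) encodes a colour together with a function Fin t → Fin T.

colourOf : ∀ {k T t} → Fin (k * T ^ t) → Fin k
colourOf {k} {T} {t} e = proj₁ (remQuot (T ^ t) e)

rowOf : ∀ {k T t} → Fin (k * T ^ t) → Fin t → Fin T
rowOf {k} {T} {t} e = finToFun (proj₂ (remQuot {k} (T ^ t) e))

encode : ∀ {k T t} → Fin k → (Fin t → Fin T) → Fin (k * T ^ t)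
encode x h = combine x (funToFin h)

colourOf-encode : ∀ {k T t} x (h : Fin t → Fin T) → colourOf {k} {T} {t} (encode x h) ≡ x
colourOf-encode {k} x h = cong proj₁ (Finₚ.remQuot-combine {k} x (funToFin h))

rowOf-encode : ∀ {k T t} x (h : Fin t → Fin T) j → rowOf {k} {T} {t} (encode x h) j ≡ h j
rowOf-encode {k} x h j = trans (cong (λ rq → finToFun (proj₂ rq) j) (Finₚ.remQuot-combine {k} x (funToFin h)))
                           (Finₚ.finToFun-funToFin h j)

module Extend {n k s T} (t : ℕ) {G : Fin n → Fin n → Bool} {c : Fin n → Fin n → Fin k}
              (B : Blowup G c s T) where
  open Blowup B

  Code : Set
  Code = Fin (k * T ^ t)

  row : Code → Fin t → Fin T
  row = rowOf {k} {T} {t}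

  colour : Code → Fin k
  colour = colourOf {k} {T} {t}

  -- A code records a t-tuple of part a along with a colour, so that vertices with equal codes can
  -- share the same shrunken part.
  record Attached (v : Fin n) (a : Fin s) (e : Code) : Set where
    constructor attached
    field
      row-inj : ∀ i j → row e i ≡ row e j → i ≡ j
      hit     : ∀ j → G (part a (row e j)) v ≡ true × c (part a (row e j)) v ≡ colour e

  Attached? : ∀ v a e → Dec (Attached v a e)
  Attached? v a e = map′ (λ (x , y) → attached x y) (λ (attached x y) → x , y)
    (Finₚ.all? (λ i → Finₚ.all? (λ j → (row e i Fin.≟ row e j) →-dec (i Fin.≟ j))) ×-dec
     Finₚ.all? (λ j → (G (part a (row e j)) v Bool.≟ true) ×-dec (c (part a (row e j)) v Fin.≟ colour e)))

  -- The number of ways to choose one code for every part. It does not depend on n, so among many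
  -- attached vertices many agree on all their codes.
  Codes : ℕ
  Codes = (k * T ^ t) ^ s

  AttachedAll : Fin n → Fin Codes → Set
  AttachedAll v w = ∀ a → Attached v a (finToFun w a)

  AttachedAll? : ∀ v w → Dec (AttachedAll v w)
  AttachedAll? v w = Finₚ.all? (λ a → Attached? v a (finToFun w a))

  load : Fin n → Fin s → ℕ
  load v a = count (λ j → G (part a j) v)

  attach : ∀ v a → k * t < load v a → ∃ (Attached v a)
  attach v a lt with select-fibre (λ j → G (part a j) v) (λ j → c (part a j) v) t lt
  ... | x , h , h-inj , ph = encode {k} x h , attached
    (λ i j eq → h-inj (trans (sym (rowOf-encode {k} x h i)) (trans eq (rowOf-encode {k} x h j))))
    (λ j → subst (λ l → G (part a l) v ≡ true × c (part a l) v ≡ colour (encode {k} x h))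
             (sym (rowOf-encode {k} x h j))
             (proj₁ (ph j) , trans (proj₂ (ph j)) (sym (colourOf-encode {k} x h))))

  attachedBy : Fin Codes → Fin n → Bool
  attachedBy w v = ⌊ AttachedAll? v w ⌋

  -- A vertex with at most k * t neighbours in some part has total load at most (s - 1) * T + k * t.
  -- Any other vertex is attached to all parts through some w, and the last term pays T for it. One
  -- inequality for both cases can be summed over v.
  load-bound : ∀ v → sum (load v) + T ≤ (s * T + k * t) + T * sum (λ w → 𝟙 (attachedBy w v))
  load-bound v with Finₚ.any? (λ a → load v a ≤? k * t)
  ... | yes (a , low) = ≤-trans (sum+bound≤ (load v) (λ b → count≤ (λ j → G (part b j) v)) a low) (m≤m+n _ _)
  ... | no  ¬low = +-mono-≤
    (≤-trans (sum≤ (load v) T (λ b → count≤ (λ j → G (part b j) v))) (m≤m+n _ _))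
    (≤-trans (≤-reflexive (sym (*-identityʳ T))) (*-monoʳ-≤ T
      (≤-trans (≤-reflexive (cong 𝟙 (sym (⌊⌋-true (AttachedAll? v w) all-attached))))
        (term≤sum (λ w → 𝟙 (attachedBy w v)) w))))
    where
    code : ∀ a → ∃ (Attached v a)
    code a = attach v a (≰⇒> (λ low → ¬low (a , low)))
    w : Fin Codes
    w = funToFin (proj₁ ∘ code)
    all-attached : AttachedAll v w
    all-attached a = subst (Attached v a) (sym (Finₚ.finToFun-funToFin (proj₁ ∘ code) a)) (proj₂ (code a))

  -- Double counting of the edges between the parts and all vertices: the minimum degree bounds `L`
  -- from below, `load-bound` from above. For s > 0, `gain` says that C / D > 1 - 1/s. The
  -- comparison leaves n ≤ D * T * N, where `N` counts attached pairs (v, w), and averaging over w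
  -- finishes.
  popular : ∀ C D R → T ≡ suc (D * (k * t)) → s * D < s * C + D → D * T * (Codes * R) < n →
            (∀ v → C * n ≤ D * deg G v) → ∃ λ w → R < count (attachedBy w)
  popular C D R T≡ gain large high =
    average (λ w → count (attachedBy w)) R
      (*-cancelˡ-< (D * T) _ _ (<-≤-trans large (+-cancelʳ-≤ (n * (T * (s * D)) + n * (D * (k * t))) _ _ main)))
    where
    open ≤-Reasoning
    N L : ℕ
    N = sum (λ w → count (attachedBy w))
    L = sum (λ v → sum (load v))
    load-sum : s * (T * (C * n)) ≤ D * L
    load-sum = begin
      s * (T * (C * n))
        ≤⟨ ≤sum _ _ (λ a → ≤sum _ _ (λ j → high (part a j))) ⟩
      sum (λ a → sum (λ j → D * deg G (part a j)))
        ≡⟨ sum-cong-≗ (λ a → sym (*-distribˡ-sum D (λ j → deg G (part a j)))) ⟩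
      sum (λ a → D * sum (λ j → deg G (part a j)))
        ≡⟨ sym (*-distribˡ-sum D (λ a → sum (λ j → deg G (part a j)))) ⟩
      D * sum (λ a → sum (λ j → sum (λ v → 𝟙 (G (part a j) v))))
        ≡⟨ cong (D *_) (sum-cong-≗ (λ a → ∑-comm (λ j v → 𝟙 (G (part a j) v)))) ⟩
      D * sum (λ a → sum (λ v → load v a))
        ≡⟨ cong (D *_) (∑-comm (λ a v → load v a)) ⟩
      D * L
        ∎
    total : L + n * T ≤ n * (s * T + k * t) + T * N
    total = begin
      L + n * T
        ≡⟨ cong (L +_) (sym (sum-const n T)) ⟩
      L + sum {n} (const T)
        ≡⟨ sym (∑-distrib-+ (λ v → sum (load v)) (const T)) ⟩
      sum (λ v → sum (load v) + T)
        ≤⟨ sum-mono load-bound ⟩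
      sum (λ v → (s * T + k * t) + T * sum (λ w → 𝟙 (attachedBy w v)))
        ≡⟨ ∑-distrib-+ {n} (const (s * T + k * t)) (λ v → T * sum (λ w → 𝟙 (attachedBy w v))) ⟩
      sum {n} (const (s * T + k * t)) + sum (λ v → T * sum (λ w → 𝟙 (attachedBy w v)))
        ≡⟨ cong₂ _+_ (sum-const n _) (sym (*-distribˡ-sum T (λ v → sum (λ w → 𝟙 (attachedBy w v))))) ⟩
      n * (s * T + k * t) + T * sum (λ v → sum (λ w → 𝟙 (attachedBy w v)))
        ≡⟨ cong (λ x → n * (s * T + k * t) + T * x) (∑-comm (λ v w → 𝟙 (attachedBy w v))) ⟩
      n * (s * T + k * t) + T * N
        ∎
    arith₁ : ∀ n T d e → n + (n * (T * d) + n * e) ≡ n * (suc e) + n * (T * d)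
    arith₁ = solve-∀
    arith₂ : ∀ n T d → n * T + n * (T * d) ≡ n * T * suc d
    arith₂ = solve-∀
    arith₃ : ∀ n T s C D → n * T * (s * C + D) ≡ s * (T * (C * n)) + D * (n * T)
    arith₃ = solve-∀
    arith₄ : ∀ n T s D x N → D * (n * (s * T + x) + T * N) ≡ D * T * N + (n * (T * (s * D)) + n * (D * x))
    arith₄ = solve-∀
    main : n + (n * (T * (s * D)) + n * (D * (k * t))) ≤ D * T * N + (n * (T * (s * D)) + n * (D * (k * t)))
    main = begin
      n + (n * (T * (s * D)) + n * (D * (k * t)))  ≡⟨ arith₁ n T (s * D) (D * (k * t)) ⟩
      -- T exceeds the loss D * (k * t) of a poorly attached vertex by one; summed over all vertices
      -- this is the surplus n.
      n * suc (D * (k * t)) + n * (T * (s * D))    ≡⟨ cong (λ x → n * x + n * (T * (s * D))) (sym T≡) ⟩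
      n * T + n * (T * (s * D))                    ≡⟨ arith₂ n T (s * D) ⟩
      n * T * suc (s * D)                          ≤⟨ *-monoʳ-≤ (n * T) gain ⟩
      n * T * (s * C + D)                          ≡⟨ arith₃ n T s C D ⟩
      s * (T * (C * n)) + D * (n * T)              ≤⟨ +-monoˡ-≤ (D * (n * T)) load-sum ⟩
      D * L + D * (n * T)                          ≡⟨ sym (*-distribˡ-+ D L (n * T)) ⟩
      D * (L + n * T)                              ≤⟨ *-monoʳ-≤ D total ⟩
      D * (n * (s * T + k * t) + T * N)            ≡⟨ arith₄ n T s D (k * t) N ⟩
      D * T * N + (n * (T * (s * D)) + n * (D * (k * t))) ∎

  extend : Symmetric G → Symmetric c → ∀ w (f : Fin t → Fin n) → Inj f → (∀ j → AttachedAll (f j) w) →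
           ∀ x → (∀ i j → i ≢ j → c (f i) (f j) ≡ x) → Blowup G c (suc s) t
  extend G-sym c-sym w f f-inj f-att x f-mono = record
    { part = part′ ; part-inj = part′-inj ; inner = inner′ ; cross = cross′ ; cross-sym = cross′-sym
    ; inner-col = inner′-col ; cross-col = cross′-col ; cross-adj = cross′-adj }
    where
    e : Fin s → Code
    e = finToFun w
    part′ : Fin (suc s) → Fin t → Fin n
    part′ zero    = f
    part′ (suc a) = part a ∘ row (e a)
    inner′ : Fin (suc s) → Fin k
    inner′ zero    = x
    inner′ (suc a) = inner a
    cross′ : Fin (suc s) → Fin (suc s) → Fin k
    -- A default value: `cross` is only read off the diagonal.
    cross′ zero    zero    = x
    cross′ zero    (suc b) = colour (e b)
    cross′ (suc a) zero    = colour (e a)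
    cross′ (suc a) (suc b) = cross a b
    -- Injectivity of a row is known through a vertex attached by it, so an index of the new part is
    -- taken as a witness. Wherever two indices of a row are compared, one is at hand.
    row-injective : Fin t → ∀ a → Inj (row (e a))
    row-injective i a {j} {l} = Attached.row-inj (f-att i a) j l
    part′-inj : ∀ a → Inj (part′ a)
    part′-inj zero    = f-inj
    part′-inj (suc a) {i} eq = row-injective i a (part-inj a eq)
    cross′-sym : Symmetric cross′
    cross′-sym zero    zero    = refl
    cross′-sym zero    (suc b) = refl
    cross′-sym (suc a) zero    = refl
    cross′-sym (suc a) (suc b) = cross-sym a b
    inner′-col : ∀ a i j → i ≢ j → c (part′ a i) (part′ a j) ≡ inner′ a
    inner′-col zero    i j i≢j = f-mono i j i≢j
    inner′-col (suc a) i j i≢j = inner-col a _ _ (i≢j ∘ row-injective i a)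
    cross′-col : ∀ a b i j → a ≢ b → c (part′ a i) (part′ b j) ≡ cross′ a b
    cross′-col zero    zero    i j a≢b = contradiction refl a≢b
    cross′-col zero    (suc b) i j a≢b = trans (c-sym _ _) (proj₂ (Attached.hit (f-att i b) j))
    cross′-col (suc a) zero    i j a≢b = proj₂ (Attached.hit (f-att j a) i)
    cross′-col (suc a) (suc b) i j a≢b = cross-col a b _ _ (a≢b ∘ cong suc)
    cross′-adj : ∀ a b i j → a ≢ b → G (part′ a i) (part′ b j) ≡ true
    cross′-adj zero    zero    i j a≢b = contradiction refl a≢b
    cross′-adj zero    (suc b) i j a≢b = trans (G-sym _ _) (proj₁ (Attached.hit (f-att i b) j))
    cross′-adj (suc a) zero    i j a≢b = proj₁ (Attached.hit (f-att j a) i)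
    cross′-adj (suc a) (suc b) i j a≢b = cross-adj a b _ _ (a≢b ∘ cong suc)

  -- First R vertices attached through one common w are collected, then `homogeneous` picks t of
  -- them spanning a single colour as the new part.
  addPart : ∀ C D R → T ≡ suc (D * (k * t)) → s * D < s * C + D → D * T * (Codes * R) < n →
         (∀ v → C * n ≤ D * deg G v) → Symmetric G → Symmetric c →
         (∀ (d : Fin R → Fin R → Fin k) → Symmetric d →
           ∃ λ x → Σ (Fin t → Fin R) λ f → Inj f × (∀ i j → i ≢ j → d (f i) (f j) ≡ x)) →
         Blowup G c (suc s) t
  addPart C D R T≡ gain large high G-sym c-sym homogeneous =
    let w , R<count = popular C D R T≡ gain large high
        u , u-inj , u-att = select (attachedBy w) R (<⇒≤ R<count)
        x , f , f-inj , f-mono = homogeneous (c on u) (λ _ _ → c-sym _ _)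
    in extend G-sym c-sym w (u ∘ f) (f-inj ∘ u-inj)
         (λ j → ⌊⌋-sound (AttachedAll? (u (f j)) w) (u-att (f j))) x f-mono

-- The Erdős–Stone theorem in minimum-degree form, with Ramsey's theorem applied inside each new part.
blowup : ∀ k C D s → (∀ s′ → s′ < s → s′ * D < s′ * C + D) → ∀ t →
  ∃ λ N → ∀ n → N < n → (G : Fin n → Fin n → Bool) → Symmetric G →
    (c : Fin n → Fin n → Fin k) → Symmetric c → (∀ v → C * n ≤ D * deg G v) → Blowup G c s t
blowup k C D zero    gain t = 0 , λ n _ G G-sym c c-sym high → record
  { part = λ () ; part-inj = λ () ; inner = λ () ; cross = λ () ; cross-sym = λ ()
  ; inner-col = λ () ; cross-col = λ () ; cross-adj = λ () }
blowup k C D (suc s) gain t = N₁ + N₂ , λ n n> G G-sym c c-sym high →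
  Extend.addPart t (proj₂ smaller n (≤-<-trans (m≤n+m N₂ N₁) n>) G G-sym c c-sym high)
    C D R refl (gain s ≤-refl) (≤-<-trans (m≤m+n N₁ N₂) n>) high G-sym c-sym (proj₂ (ramsey k t))
  where
  M R N₁ N₂ : ℕ
  -- The old parts get the size that `popular` prescribes for T, and `N₁` is its threshold for this
  -- size.
  M = suc (D * (k * t))
  R = proj₁ (ramsey k t)
  smaller = blowup k C D s (λ s′ lt → gain s′ (m<n⇒m<1+n lt)) M
  N₁ = D * M * ((k * M ^ t) ^ s * R)
  N₂ = proj₁ smaller

-- Reflection of the Boolean definitions

any-intro : ∀ {A : Set} (p : A → Bool) {xs} → Any (λ x → p x ≡ true) xs → any p xs ≡ true
any-intro p = Equivalence.to T-≡ ∘ Anyₚ.any⁺ p ∘ Any.map (Equivalence.from T-≡)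

any-elim : ∀ {A : Set} (p : A → Bool) xs → any p xs ≡ true → ∃ λ x → p x ≡ true
any-elim p xs eq with Any.satisfied (Anyₚ.any⁻ p xs (Equivalence.from T-≡ eq))
... | x , px = x , Equivalence.to T-≡ px

all-intro : ∀ {A : Set} (p : A → Bool) xs → (∀ x → p x ≡ true) → all p xs ≡ true
all-intro p xs px = Equivalence.to T-≡ (Allₚ.all⁻ p (All.universal (Equivalence.from T-≡ ∘ px) xs))

all-elim : ∀ {A : Set} (p : A → Bool) {xs x} → all p xs ≡ true → x ∈ xs → p x ≡ true
all-elim p eq x∈xs = Equivalence.to T-≡ (All.lookup (Allₚ.all⁺ p _ (Equivalence.from T-≡ eq)) x∈xs)

∈-allFin : ∀ {n} (i : Fin n) → i ∈ allFin n
∈-allFin i = Anyₚ.tabulate⁺ i refl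

∈-pairs : ∀ {m} (a b : Fin m) → (a , b) ∈ pairs m
∈-pairs a b = Anyₚ.concatMap⁺ _ (Anyₚ.tabulate⁺ a (Anyₚ.map⁺ (Anyₚ.tabulate⁺ b refl)))

-- Stated pointwise, as function extensionality is not assumed; `inMonoCopy-intro` therefore
-- transports a copy along pointwise equality.
allFuns-complete : ∀ {m n} (f : Fin m → Fin n) → Any (λ g → ∀ a → g a ≡ f a) (allFuns m n)
allFuns-complete {zero}  f = here λ ()
allFuns-complete {suc m} f = Anyₚ.concatMap⁺ _ (Anyₚ.tabulate⁺ (f zero) (Anyₚ.map⁺
  (Any.map (λ eq → λ { zero → refl ; (suc a) → eq a }) (allFuns-complete (f ∘ suc)))))

-- The propositional form of `inMonoCopy`. The colouring is a bare function, so that it can be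
-- restricted to an induced subgraph by `_on_`.
record Copy {n k} (c : Fin n → Fin n → Fin k) (H : Graph) (i : Fin k) (u v : Fin n) : Set where
  field
    emb      : Fin (size H) → Fin n
    emb-inj  : Inj emb
    mono     : ∀ a b → adj H a b ≡ true → c (emb a) (emb b) ≡ i
    {p q}    : Fin (size H)
    edge     : adj H p q ≡ true
    emb-p    : emb p ≡ u
    emb-q    : emb q ≡ v

Copy-sym : ∀ {n k} {c : Fin n → Fin n → Fin k} {H i u v} → Copy c H i u v → Copy c H i v u
Copy-sym {H = H} K = record
  { emb = emb ; emb-inj = emb-inj ; mono = mono
  ; edge = trans (adj-sym H _ _) edge ; emb-p = emb-q ; emb-q = emb-p }
  where open Copy K

Copy-map : ∀ {m n k} {c : Fin n → Fin n → Fin k} (ι : Fin m → Fin n) → Inj ι →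
           ∀ {H i u v} → Copy (c on ι) H i u v → Copy c H i (ι u) (ι v)
Copy-map ι ι-inj K = record
  { emb = ι ∘ emb ; emb-inj = emb-inj ∘ ι-inj ; mono = mono
  ; edge = edge ; emb-p = cong ι emb-p ; emb-q = cong ι emb-q }
  where open Copy K

module _ {n k} (φ : Colouring n k) where

  isMonoCopy-intro : ∀ H i (g : Fin (size H) → Fin n) → Inj g →
    (∀ a b → adj H a b ≡ true → col φ (g a) (g b) ≡ i) → isMonoCopy φ H i g ≡ true
  isMonoCopy-intro H i g g-inj mono =
    cong₂ _∧_ (all-intro _ (pairs (size H)) λ (a , b) → distinct a b)
              (all-intro _ (pairs (size H)) λ (a , b) → coloured a b)
    where
    distinct : ∀ a b → eqᵇ a b ∨ not (eqᵇ (g a) (g b)) ≡ true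
    distinct a b with a Fin.≟ b
    ... | yes _ = refl
    ... | no a≢b with g a Fin.≟ g b
    ...   | yes ga≡gb = contradiction (g-inj ga≡gb) a≢b
    ...   | no  _     = refl
    coloured : ∀ a b → not (adj H a b) ∨ eqᵇ (col φ (g a) (g b)) i ≡ true
    coloured a b with adj H a b in e
    ... | false = refl
    ... | true  = ⌊⌋-true (col φ (g a) (g b) Fin.≟ i) (mono a b e)

  isMonoCopy-elim : ∀ H i (g : Fin (size H) → Fin n) → isMonoCopy φ H i g ≡ true →
    Inj g × (∀ a b → adj H a b ≡ true → col φ (g a) (g b) ≡ i)
  isMonoCopy-elim H i g eq = g-inj , mono
    where
    g-inj : Inj g
    g-inj {a} {b} ga≡gb with a Fin.≟ b | all-elim _ (proj₁ (∧-true eq)) (∈-pairs a b)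
    ... | yes a≡b | _ = a≡b
    ... | no  _   | d with g a Fin.≟ g b
    ...   | no ga≢gb = contradiction ga≡gb ga≢gb
    g-inj {a} {b} ga≡gb | no _ | () | yes _
    mono : ∀ a b → adj H a b ≡ true → col φ (g a) (g b) ≡ i
    mono a b e = ⌊⌋-sound (col φ (g a) (g b) Fin.≟ i)
      (subst (λ x → not x ∨ eqᵇ (col φ (g a) (g b)) i ≡ true) e
        (all-elim _ (proj₂ (∧-true eq)) (∈-pairs a b)))

  inMonoCopy-intro : ∀ {H i u v} → Copy (col φ) H i u v → inMonoCopy φ H i u v ≡ true
  inMonoCopy-intro {H} {i} {u} {v} K = any-intro _ (Any.map found (allFuns-complete emb))
    where
    open Copy K
    found : ∀ {g} → (∀ a → g a ≡ emb a) → isMonoCopy φ H i g ∧ hitsEdge H g u v ≡ true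
    found {g} g≗ = cong₂ _∧_
      (isMonoCopy-intro H i g (λ {a} {b} eq → emb-inj (trans (sym (g≗ a)) (trans eq (g≗ b))))
        (λ a b e → trans (cong₂ (col φ) (g≗ a) (g≗ b)) (mono a b e)))
      (any-intro _ (Any.map (λ { refl → cong₂ _∧_ edge (cong₂ _∧_
          (⌊⌋-true (g p Fin.≟ u) (trans (g≗ p) emb-p))
          (⌊⌋-true (g q Fin.≟ v) (trans (g≗ q) emb-q))) }) (∈-pairs p q)))

  inMonoCopy-elim : ∀ {H i u v} → inMonoCopy φ H i u v ≡ true → Copy (col φ) H i u v
  inMonoCopy-elim {H} {i} {u} {v} eq with any-elim _ (allFuns (size H) n) eq
  ... | g , pg with isMonoCopy-elim H i g (proj₁ (∧-true pg)) | any-elim _ (pairs (size H)) (proj₂ (∧-true pg))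
  ...   | g-inj , mono | (p , q) , hit = record
    { emb = g ; emb-inj = g-inj ; mono = mono ; edge = proj₁ (∧-true hit)
    ; emb-p = ⌊⌋-sound (g p Fin.≟ u) (proj₁ (∧-true (proj₂ (∧-true {adj H p q} hit))))
    ; emb-q = ⌊⌋-sound (g q Fin.≟ v) (proj₂ (∧-true (proj₂ (∧-true {adj H p q} hit)))) }

  module _ (H : Fin k → Graph) where

    isNIM-elim : ∀ {u v} → isNIM φ H u v ≡ true → ∀ i → ¬ Copy (col φ) (H i) i u v
    isNIM-elim {u} {v} eq i K = contradiction
      (trans (cong not (sym (any-intro (λ i → inMonoCopy φ (H i) i u v)
        (Any.map (λ { refl → inMonoCopy-intro K }) (∈-allFin i))))) eq) λ ()

    isNIM-intro : ∀ {u v} → (∀ i → ¬ Copy (col φ) (H i) i u v) → isNIM φ H u v ≡ true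
    isNIM-intro {u} {v} free with any (λ i → inMonoCopy φ (H i) i u v) (allFin k) in eq
    ... | false = refl
    ... | true with any-elim _ (allFin k) eq
    ...   | i , found = contradiction (inMonoCopy-elim found) (free i)

-- Counting NIM-edges and the NIM-graph

length-filterᵇ-∧ : ∀ {A : Set} (p q : A → Bool) xs →
                   length (filterᵇ p (filterᵇ q xs)) ≡ length (filterᵇ (λ x → q x ∧ p x) xs)
length-filterᵇ-∧ p q [] = refl
length-filterᵇ-∧ p q (x ∷ xs) with q x
... | false = length-filterᵇ-∧ p q xs
... | true with p x
...   | false = length-filterᵇ-∧ p q xs
...   | true  = cong suc (length-filterᵇ-∧ p q xs)

length-filterᵇ-mono : ∀ {A : Set} (p q : A → Bool) → (∀ x → p x ≡ true → q x ≡ true) →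
                      ∀ xs → length (filterᵇ p xs) ≤ length (filterᵇ q xs)
length-filterᵇ-mono p q p⇒q [] = z≤n
length-filterᵇ-mono p q p⇒q (x ∷ xs) with p x in px | q x in qx
... | false | false = length-filterᵇ-mono p q p⇒q xs
... | false | true  = m≤n⇒m≤1+n (length-filterᵇ-mono p q p⇒q xs)
... | true  | true  = s≤s (length-filterᵇ-mono p q p⇒q xs)
... | true  | false = contradiction (trans (sym qx) (p⇒q x px)) λ ()

length-filterᵇ-map : ∀ {A B : Set} (p : B → Bool) (h : A → B) {n} (f : Fin n → A) →
                     length (filterᵇ p (map h (tabulate f))) ≡ count (p ∘ h ∘ f)
length-filterᵇ-map p h {zero}  f = refl
length-filterᵇ-map p h {suc n} f with p (h (f zero))
... | false = length-filterᵇ-map p h (f ∘ suc)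
... | true  = cong suc (length-filterᵇ-map p h (f ∘ suc))

length-filterᵇ-concatMap : ∀ {A B : Set} (p : B → Bool) (h : A → List B) {n} (f : Fin n → A) →
  length (filterᵇ p (concatMap h (tabulate f))) ≡ sum (λ i → length (filterᵇ p (h (f i))))
length-filterᵇ-concatMap p h {zero}  f = refl
length-filterᵇ-concatMap p h {suc n} f =
  trans (cong length (filter-++ (T? ∘ p) (h (f zero)) (concatMap h (tabulate (f ∘ suc)))))
  (trans (length-++ (filterᵇ p (h (f zero))))
         (cong (length (filterᵇ p (h (f zero))) +_) (length-filterᵇ-concatMap p h (f ∘ suc))))

length-filterᵇ-pairs : ∀ {m} (p : Fin m × Fin m → Bool) →
  length (filterᵇ p (pairs m)) ≡ sum (λ a → count (λ b → p (a , b)))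
length-filterᵇ-pairs {m} p =
  trans (length-filterᵇ-concatMap p (λ a → map (a ,_) (allFin m)) id)
        (sum-cong-≗ (λ a → length-filterᵇ-map p (a ,_) id))

_<ᶠ_ : ∀ {n} → Fin n → Fin n → Bool
u <ᶠ v = toℕ u <ᵇ toℕ v

<ᶠ-asym : ∀ {n} (u v : Fin n) → u <ᶠ v ≡ true → v <ᶠ u ≡ true → ⊥
<ᶠ-asym u v u<v v<u = <-asym (<ᵇ⇒< _ _ (Equivalence.from T-≡ u<v)) (<ᵇ⇒< (toℕ v) _ (Equivalence.from T-≡ v<u))

module NimGraph {n k} (φ : Colouring n k) (H : Fin k → Graph) where

  -- `nimφ` counts pairs with u < v, so the adjacency matrix is built by reflecting its upper
  -- triangle.
  upper : Fin n → Fin n → Bool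
  upper u v = u <ᶠ v ∧ isNIM φ H u v

  nimGraph : Fin n → Fin n → Bool
  nimGraph u v = upper u v ∨ upper v u

  nimGraph-sym : Symmetric nimGraph
  nimGraph-sym u v = ∨-comm (upper u v) (upper v u)

  nimGraph-irrefl : Irreflexive nimGraph
  nimGraph-irrefl u with u <ᶠ u in eq
  ... | false = refl
  ... | true  = ⊥-elim (<ᶠ-asym u u eq eq)

  nimGraph-free : ∀ {u v} → nimGraph u v ≡ true → ∀ i → ¬ Copy (col φ) (H i) i u v
  nimGraph-free {u} {v} eq i K with upper u v in up
  ... | true  = isNIM-elim φ H (proj₂ (∧-true {u <ᶠ v} up)) i K
  ... | false = isNIM-elim φ H (proj₂ (∧-true {v <ᶠ u} eq)) i (Copy-sym K)

  𝟙-nimGraph : ∀ u v → 𝟙 (nimGraph u v) ≡ 𝟙 (upper u v) + 𝟙 (upper v u)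
  𝟙-nimGraph u v with upper u v in uv | upper v u in vu
  ... | false | _     = refl
  ... | true  | false = refl
  ... | true  | true  = ⊥-elim (<ᶠ-asym u v (proj₁ (∧-true uv)) (proj₁ (∧-true vu)))

  nimφ≡ : nimφ φ H ≡ sum (λ u → count (upper u))
  nimφ≡ = trans (length-filterᵇ-∧ _ _ (pairs n)) (length-filterᵇ-pairs {n} _)

  -- The handshake lemma: the two triangles are disjoint and each sums to `nimφ φ H`.
  degreeSum-nimGraph : degreeSum nimGraph ≡ 2 * nimφ φ H
  degreeSum-nimGraph = begin-equality
    sum (λ u → sum (λ v → 𝟙 (nimGraph u v)))
      ≡⟨ sum-cong-≗ (λ u → trans (sum-cong-≗ (𝟙-nimGraph u))
           (∑-distrib-+ (λ v → 𝟙 (upper u v)) (λ v → 𝟙 (upper v u)))) ⟩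
    sum (λ u → count (upper u) + sum (λ v → 𝟙 (upper v u)))
      ≡⟨ ∑-distrib-+ (λ u → count (upper u)) (λ u → sum (λ v → 𝟙 (upper v u))) ⟩
    sum (λ u → count (upper u)) + sum (λ u → sum (λ v → 𝟙 (upper v u)))
      ≡⟨ cong₂ _+_ (sym nimφ≡) (trans (∑-comm (λ u v → 𝟙 (upper v u))) (sym nimφ≡)) ⟩
    nimφ φ H + nimφ φ H
      ≡⟨ cong (nimφ φ H +_) (sym (+-identityʳ _)) ⟩
    2 * nimφ φ H
      ∎
    where open ≤-Reasoning

-- The upper bound

-- Without edges a constant map is a bipartition. The negative form suffices, since it is applied
-- only where the goal is `⊥`.
nonBipartite⇒edge : ∀ H → ¬ Bipartite H → ¬ (∀ p q → adj H p q ≢ true)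
nonBipartite⇒edge H nonbip noedge = nonbip (const true , λ p q e _ → noedge p q e)

blowup⇒feasible : ∀ {n k s t} {G : Fin n → Fin n → Bool} {c : Fin n → Fin n → Fin k} (H : Fin k → Graph) →
  (∀ i → ¬ Bipartite (H i)) → (∀ i → size (H i) ≤ t) → Irreflexive G →
  (∀ {u v} → G u v ≡ true → ∀ i → ¬ Copy c (H i) i u v) → Blowup G c s t → Feasible H s
blowup⇒feasible {n} {k} {s} {t} {G} {c} H nonbip size≤t G-irr free B = record
  { ξ₁ = inner ; ξ₂ = cross ; ξ₂-sym = cross-sym ; P1 = no-hom ; P2 = cross≢inner }
  where
  open Blowup B

  part-inj₂ : ∀ a b x y → part a x ≡ part b y → x ≡ y
  part-inj₂ a b x y eq with a Fin.≟ b
  ... | yes refl = part-inj a eq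
  ... | no  a≢b  = contradiction
    (trans (sym (cross-adj a b x y a≢b)) (trans (cong (λ z → G z (part b y)) eq) (G-irr (part b y)))) λ ()

  slot : ∀ i → Fin (size (H i)) → Fin t
  slot i p = inject≤ p (size≤t i)

  slot-inj : ∀ i → Inj (slot i)
  slot-inj i = Finₚ.inject≤-injective (size≤t i) (size≤t i) _ _

  -- Each vertex has its own slot and the parts are disjoint, so the placement is injective even if
  -- `f` is not. An edge between parts would be a NIM-edge in a monochromatic copy.
  no-copy : ∀ i (f : Fin (size (H i)) → Fin s) →
    (∀ p q → adj (H i) p q ≡ true → c (part (f p) (slot i p)) (part (f q) (slot i q)) ≡ i) →
    ∀ p q → adj (H i) p q ≡ true → f p ≢ f q → ⊥
  no-copy i f mono p q e fp≢fq = free (cross-adj (f p) (f q) (slot i p) (slot i q) fp≢fq) i record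
    { emb = λ p → part (f p) (slot i p) ; emb-inj = slot-inj i ∘ part-inj₂ _ _ _ _
    ; mono = mono ; edge = e ; emb-p = refl ; emb-q = refl }

  no-hom : ∀ i → ¬ Hom (H i) s (λ a b → a ≢ b × cross a b ≡ i)
  no-hom i (f , f-hom) = nonBipartite⇒edge (H i) (nonbip i) λ p q e →
    no-copy i f (λ p q e → trans (cross-col _ _ _ _ (proj₁ (f-hom p q e))) (proj₂ (f-hom p q e)))
      p q e (proj₁ (f-hom p q e))

  cross≢inner : ∀ a b → a ≢ b → cross a b ≢ inner a
  cross≢inner a b a≢b eq = nonBipartite⇒edge (H i) (nonbip i) single
    where
    i : Fin k
    i = inner a
    single : ∀ p q → adj (H i) p q ≢ true
    single p q e = no-copy i place mono p q e place-p≢q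
      where
      -- Only the end q of the given edge goes to part b. Having no loops, the graph has no edge
      -- inside b, so all its edges get colour `cross a b` or `inner a`, both equal to i.
      place : Fin (size (H i)) → Fin s
      place x with x Fin.≟ q
      ... | yes _ = b
      ... | no  _ = a
      irr : ∀ x → adj (H i) x x ≢ true
      irr x ex = contradiction (trans (sym ex) (adj-irrefl (H i) x)) λ ()
      mono : ∀ x y → adj (H i) x y ≡ true → c (part (place x) (slot i x)) (part (place y) (slot i y)) ≡ i
      mono x y exy with x Fin.≟ q | y Fin.≟ q
      ... | yes refl | yes refl = contradiction exy (irr x)
      ... | yes _    | no  _    = trans (cross-col b a _ _ (a≢b ∘ sym)) (trans (cross-sym b a) eq)
      ... | no  _    | yes _    = trans (cross-col a b _ _ a≢b) eq
      ... | no  _    | no  _    = inner-col a _ _ λ sx≡sy →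
        irr x (subst (λ z → adj (H i) x z ≡ true) (sym (slot-inj i sx≡sy)) exy)
      place-p≢q : place p ≢ place q
      place-p≢q with p Fin.≟ q | q Fin.≟ q
      ... | yes refl | _       = contradiction e (irr p)
      ... | no  _    | yes _   = a≢b
      ... | no  _    | no  q≢q = contradiction refl q≢q

-- Here r + 1 stands for r* and p / q for ε: C / D = 1 - 1/(r + 1) + ε, while the degree sum exceeds
-- (1 - 1/(r + 1) + 2ε) n². The deletions cannot use up the spare ε n², so m must grow with n.
dense⇒minDegree : ∀ r p q → 0 < p → ∀ N n → suc (r * q + suc r * p + suc r * q * (N * N)) ≤ n →
  (G : Fin n → Fin n → Bool) → Symmetric G → Irreflexive G →
  r * q * (n * n) + 2 * suc r * p * (n * n) < suc r * q * degreeSum G →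
  ∃ λ m → Σ (Fin m → Fin n) λ ι → Inj ι × N < m ×
    (∀ v → (r * q + suc r * p) * m ≤ suc r * q * deg (G on ι) v)
dense⇒minDegree r p q 0<p N n n≥ G G-sym G-irr dense
  with minDegree (r * q + suc r * p) (suc r * q) n G G-sym G-irr
... | m , ι , ι-inj , high , potential = m , ι , ι-inj , N<m , high
  where
  open ≤-Reasoning
  C D : ℕ
  C = r * q + suc r * p
  D = suc r * q
  arith₁ : ∀ x y z → x * z + (y + x) * z ≡ y * z + 2 * x * z
  arith₁ = solve-∀
  arith₂ : ∀ x C n → x + C * (n * n + n) ≡ (x + C * n) + C * (n * n)
  arith₂ = solve-∀
  arith₃ : ∀ x C n → x * n + C * n ≡ (C + x) * n
  arith₃ = solve-∀

  0<r*p : 0 < suc r * p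
  0<r*p = *-mono-≤ (s≤s (z≤n {r})) 0<p

  excess : suc r * p * (n * n) < D * (m * m) + C * n
  excess = +-cancelʳ-< (C * (n * n)) _ _ (begin-strict
    suc r * p * (n * n) + C * (n * n)
      ≡⟨ arith₁ (suc r * p) (r * q) (n * n) ⟩
    r * q * (n * n) + 2 * (suc r * p) * (n * n)
      ≡⟨ cong (λ x → r * q * (n * n) + x * (n * n)) (sym (*-assoc 2 (suc r) p)) ⟩
    r * q * (n * n) + 2 * suc r * p * (n * n)
      <⟨ dense ⟩
    D * degreeSum G
      ≤⟨ m≤m+n (D * degreeSum G) (C * (m * m + m)) ⟩
    D * degreeSum G + C * (m * m + m)
      ≤⟨ potential ⟩
    D * degreeSum (G on ι) + C * (n * n + n)
      ≤⟨ +-monoˡ-≤ (C * (n * n + n)) (*-monoʳ-≤ D (degreeSum≤ (G on ι))) ⟩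
    D * (m * m) + C * (n * n + n)
      ≡⟨ arith₂ (D * (m * m)) C n ⟩
    (D * (m * m) + C * n) + C * (n * n) ∎)

  N<m : N < m
  -- If m ≤ N, then `excess` bounds n * n by a term linear in n, whose coefficient C + D * (N * N)
  -- is below n.
  N<m = ≰⇒> λ m≤N → <-irrefl refl (begin-strict
    n * n                    ≤⟨ m≤n*m (n * n) (suc r * p) {{ℕ.>-nonZero 0<r*p}} ⟩
    suc r * p * (n * n)      <⟨ excess ⟩
    D * (m * m) + C * n      ≤⟨ +-monoˡ-≤ (C * n) (*-monoʳ-≤ D (*-mono-≤ m≤N m≤N)) ⟩
    D * (N * N) + C * n      ≤⟨ +-monoˡ-≤ (C * n) (m≤m*n (D * (N * N)) n {{ℕ.>-nonZero (≤-trans (s≤s z≤n) n≥)}}) ⟩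
    D * (N * N) * n + C * n  ≡⟨ arith₃ (D * (N * N)) C n ⟩
    (C + D * (N * N)) * n    ≤⟨ *-monoˡ-≤ n (<⇒≤ n≥) ⟩
    n * n                    ∎)

dense⇒blowup : ∀ k r p q → 0 < p → 0 < q → ∀ t → ∃ λ n₀ → ∀ n → n₀ ≤ n →
  (G : Fin n → Fin n → Bool) → Symmetric G → Irreflexive G → (c : Fin n → Fin n → Fin k) → Symmetric c →
  r * q * (n * n) + 2 * suc r * p * (n * n) < suc r * q * degreeSum G →
  ∃ λ m → Σ (Fin m → Fin n) λ ι → Inj ι × Blowup (G on ι) (c on ι) (suc (suc r)) t
dense⇒blowup k r p q 0<p 0<q t =
  let N , build = blowup k C D (suc (suc r)) gain t in
  suc (C + D * (N * N)) , λ n n≥ G G-sym G-irr c c-sym dense →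
    let m , ι , ι-inj , N<m , high = dense⇒minDegree r p q 0<p N n n≥ G G-sym G-irr dense in
    m , ι , ι-inj , build m N<m (G on ι) (λ u v → G-sym (ι u) (ι v)) (c on ι) (λ u v → c-sym (ι u) (ι v)) high
  where
  open ≤-Reasoning
  C D : ℕ
  C = r * q + suc r * p
  D = suc r * q

  gain : ∀ s → s < suc (suc r) → s * D < s * C + D
  gain s s<r+2 = begin-strict
    s * D                                   ≡⟨ arith₁ s r q ⟩
    s * (r * q) + s * q                     <⟨ +-monoʳ-< (s * (r * q)) (slack s s<r+2) ⟩
    s * (r * q) + (s * (suc r * p) + D)     ≡⟨ arith₂ s (r * q) (suc r * p) D ⟩
    s * C + D                               ∎
    where
    arith₁ : ∀ s r q → s * (suc r * q) ≡ s * (r * q) + s * q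
    arith₁ = solve-∀
    arith₂ : ∀ s x y D → s * x + (s * y + D) ≡ s * (x + y) + D
    arith₂ = solve-∀
    -- Strictness comes from q > 0 when s = 0. Otherwise s ≤ r + 1 gives the weak inequality and p >
    -- 0 makes it strict.
    slack : ∀ s → s < suc (suc r) → s * q < s * (suc r * p) + D
    slack zero    _         = *-mono-≤ (s≤s (z≤n {r})) 0<q
    slack (suc s) (s≤s s≤r) = +-mono-≤ (*-mono-≤ (s≤s (z≤n {s})) (*-mono-≤ (s≤s (z≤n {r})) 0<p)) (*-monoˡ-≤ q s≤r)

-- With ε = p / q this is the bound (1 - 1/r) n²/2 + ε n², multiplied by 2 * r * q to stay within
-- the natural numbers.
upperBound : ∀ {k} (H : Fin k → Graph) → (∀ i → ¬ Bipartite (H i)) → ∀ r → ¬ Feasible H (suc r) →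
  ∀ p q → 0 < p → 0 < q → ∃ λ n₀ → ∀ n → n₀ ≤ n → (φ : Colouring n k) →
    2 * r * q * nimφ φ H ≤ (r ∸ 1) * q * (n * n) + 2 * r * p * (n * n)
upperBound H nonbip zero _ p q _ _ = 0 , λ _ _ _ → z≤n
upperBound {k} H nonbip (suc r) infeasible p q 0<p 0<q = proj₁ large , bound
  where
  -- The sum of the orders of all the graphs is a part size that bounds each order.
  large = dense⇒blowup k r p q 0<p 0<q (sum (size ∘ H))
  arith : ∀ r q x → 2 * r * q * x ≡ r * q * (2 * x)
  arith = solve-∀
  bound : ∀ n → proj₁ large ≤ n → (φ : Colouring n k) →
    2 * suc r * q * nimφ φ H ≤ r * q * (n * n) + 2 * suc r * p * (n * n)
  bound n n≥ φ = ≮⇒≥ λ dense → sparse (<-≤-trans dense (≤-reflexive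
    (trans (arith (suc r) q (nimφ φ H)) (cong (suc r * q *_) (sym degreeSum-nimGraph)))))
    where
    open NimGraph φ H
    sparse : ¬ (r * q * (n * n) + 2 * suc r * p * (n * n) < suc r * q * degreeSum nimGraph)
    sparse dense =
      let m , ι , ι-inj , B = proj₂ large n n≥ nimGraph nimGraph-sym nimGraph-irrefl (col φ) (col-sym φ) dense
      in infeasible (blowup⇒feasible H nonbip (term≤sum (size ∘ H)) (λ u → nimGraph-irrefl (ι u))
           (λ {u} {v} Guv i K → nimGraph-free {ι u} {ι v} Guv i (Copy-map ι ι-inj K)) B)

-- The lower bound

module Paint {k r} (H : Fin k → Graph) (ξ : Feasible H r) where

  paint : Fin r → Fin r → Fin k
  paint a b with a Fin.≟ b
  ... | yes _ = ξ₁ ξ a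
  ... | no  _ = ξ₂ ξ a b

  paint-≡ : ∀ {a b} → a ≡ b → paint a b ≡ ξ₁ ξ a
  paint-≡ {a} {b} a≡b with a Fin.≟ b
  ... | yes _   = refl
  ... | no  a≢b = contradiction a≡b a≢b

  paint-≢ : ∀ {a b} → a ≢ b → paint a b ≡ ξ₂ ξ a b
  paint-≢ {a} {b} a≢b with a Fin.≟ b
  ... | yes a≡b = contradiction a≡b a≢b
  ... | no  _   = refl

  paint-sym : ∀ a b → paint a b ≡ paint b a
  paint-sym a b with a Fin.≟ b
  ... | yes refl = sym (paint-≡ refl)
  ... | no  a≢b  = trans (ξ₂-sym ξ a b) (sym (paint-≢ (a≢b ∘ sym)))

  module _ {n} (class : Fin n → Fin r) {i u v} (K : Copy (paint on class) (H i) i u v) where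
    open Copy K

    κ : Fin (size (H i)) → Fin r
    κ = class ∘ emb

    Crossing : Fin (size (H i)) → Set
    Crossing a = ∃ λ b → adj (H i) a b ≡ true × κ a ≢ κ b

    not-all-crossing : ¬ (∀ a b → adj (H i) a b ≡ true → κ a ≢ κ b)
    not-all-crossing crossing = P1 ξ i (κ , λ a b e →
      crossing a b e , trans (sym (paint-≢ (crossing a b e))) (mono a b e))

    crossing-colour : ∀ {a} → Crossing a → ξ₁ ξ (κ a) ≢ i
    crossing-colour {a} (b , e , κa≢κb) eq =
      P2 ξ (κ a) (κ b) κa≢κb (trans (trans (sym (paint-≢ κa≢κb)) (mono a b e)) (sym eq))

    inside-colour : ∀ {a b} → adj (H i) a b ≡ true → κ a ≡ κ b → ξ₁ ξ (κ a) ≡ i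
    inside-colour {a} {b} e κa≡κb = trans (sym (paint-≡ κa≡κb)) (mono a b e)

    -- By P2 a vertex of a monochromatic copy cannot have both an edge inside its class and one leaving it.
    crossing-reach : ∀ {a b} → Crossing a → Reach (H i) a b → Crossing b
    crossing-reach cr here = cr
    crossing-reach {a} cr (step {v = w} e path) = crossing-reach
      (a , trans (adj-sym (H i) w a) e , λ κw≡κa → crossing-colour cr (inside-colour e (sym κw≡κa))) path

    edge-crossing : class u ≢ class v → Crossing p
    edge-crossing u≢v = q , edge , λ κp≡κq →
      u≢v (trans (cong class (sym emb-p)) (trans κp≡κq (cong class emb-q)))

    -- If the edge left its class, connectivity would make every vertex crossing. By colour no edge
    -- could then lie inside a class, against `not-all-crossing`.
    connected-free : Connected (H i) → class u ≡ class v
    connected-free conn = decidable-stable (class u Fin.≟ class v) λ u≢v →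
      not-all-crossing λ a b e κa≡κb →
        crossing-colour (crossing-reach (edge-crossing u≢v) (conn p a)) (inside-colour e κa≡κb)

    -- One crossing edge shows that i is not the common singleton colour, so no edge of the copy
    -- lies inside a class.
    constant-free : (∀ a b → ξ₁ ξ a ≡ ξ₁ ξ b) → class u ≡ class v
    constant-free const-ξ₁ = decidable-stable (class u Fin.≟ class v) λ u≢v →
      not-all-crossing λ a b e κa≡κb →
        crossing-colour (edge-crossing u≢v) (trans (const-ξ₁ (κ p) (κ a)) (inside-colour e κa≡κb))

  classColouring : ∀ {n} → (Fin n → Fin r) → Colouring n k
  classColouring class = record { col = paint on class ; col-sym = λ u v → paint-sym (class u) (class v) }

-- Both numbers filter the list `edgesK n`, so it is enough that every Turán edge is a NIM-edge.
turán≤nimφ : ∀ {n k s} (φ : Colouring n k) (H : Fin k → Graph) →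
  (∀ {i u v} → Copy (col φ) (H i) i u v → toℕ u mod suc s ≡ toℕ v mod suc s) →
  turán n (suc s) ≤ nimφ φ H
turán≤nimφ {n} {s = s} φ H same = length-filterᵇ-mono _ _
  (λ (u , v) differ → isNIM-intro φ H λ i K → contradiction
    (trans (sym differ) (cong not (Equivalence.to T-≡ (≡⇒≡ᵇ (toℕ u % suc s) (toℕ v % suc s)
      (residues {toℕ u} {toℕ v} (same {i} {u} {v} K)))))) λ ())
  (edgesK n)
  where
  residues : ∀ {x y} → x mod suc s ≡ y mod suc s → x % suc s ≡ y % suc s
  residues {x} {y} eq = trans (sym (Finₚ.toℕ-fromℕ< (m%n<n x (suc s))))
    (trans (cong toℕ eq) (Finₚ.toℕ-fromℕ< (m%n<n y (suc s))))

lowerBound : ∀ {k} → 1 ≤ k → (H : Fin k → Graph) → ∀ r → Feasible H r →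
  ((∀ i → Connected (H i)) ⊎ (Σ (Feasible H r) λ ξ → ∀ a b → ξ₁ ξ a ≡ ξ₁ ξ b)) →
  ∀ n → Σ (Colouring n k) λ φ → turán n r ≤ nimφ φ H
-- `turán n 0` is 0, so any colouring serves; `1≤k` supplies its one colour.
lowerBound 1≤k H zero    _ _ n = record { col = λ _ _ → Fin.fromℕ< 1≤k ; col-sym = λ _ _ → refl } , z≤n
lowerBound _   H (suc s) ξ (inj₁ connected) n = classColouring class , turán≤nimφ (classColouring class) H λ {i} {u} {v} K →
  connected-free class {i} {u} {v} K (connected i)
  where
  open Paint H ξ
  class : Fin n → Fin (suc s)
  class u = toℕ u mod suc s
lowerBound _   H (suc s) _ (inj₂ (ξ , constant)) n = classColouring class , turán≤nimφ (classColouring class) H λ {i} {u} {v} K →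
  constant-free class {i} {u} {v} K constant
  where
  open Paint H ξ
  class : Fin n → Fin (suc s)
  class u = toℕ u mod suc s

theorem1p5 : (k : ℕ) → 1 ≤ k → (H : Fin k → Graph) → (∀ i → ¬ Bipartite (H i)) →
    (r : ℕ) → IsRStar H r →
    ((p q : ℕ) → 0 < p → 0 < q →
    ∃ λ n₀ → ∀ n → n₀ ≤ n → (φ : Colouring n k) →
    2 * r * q * nimφ φ H ≤ (r ∸ 1) * q * (n * n) + 2 * r * p * (n * n))
    ×
    (((∀ i → Connected (H i)) ⊎
    (Σ (Feasible H r) λ ξ → ∀ a b → ξ₁ ξ a ≡ ξ₁ ξ b)) →
    ∀ n → Σ (Colouring n k) λ φ → turán n r ≤ nimφ φ H)
theorem1p5 k 1≤k H nonbip r (feasible , maximal) =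
  upperBound H nonbip r (λ ξ → <-irrefl refl (maximal (suc r) ξ)) , lowerBound 1≤k H r feasible
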